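{- Let $u,v,w$ be words of length $N$. For an oriented TFPL $f$ with boundary $(u,v;w)$, let $M_o(f)$ be the set of edges of $f$ oriented from an odd vertex to an even vertex, and $M_e(f)$ the set of edges of $f$ oriented from an even vertex to an odd vertex. Then $f\mapsto (M_o(f),M_e(f))$ is a bijection between the set of oriented TFPLs with boundary $(u,v;w)$ and the set of ordered pairs $(M_o,M_e)$ where $M_o$ is a perfect matching of $G^N_o(u,w)$, $M_e$ is a perfect matching of $G^N_e(v,w)$, and $M_o$ and $M_e$ are disjoint as sets of edges of $G^N$.
   Context: Let $N\ge 1$. $G^N$ is the induced subgraph of the square lattice $\mathbb{Z}^2$ formed by $N$ consecutive, horizontally centred rows having $3,5,\dots,2N+1$ vertices from top to bottom. It is bipartite; vertices of the same colour as the leftmost vertex of each row are called odd, the others even. Let $B_1,\dots,B_N$ be the even vertices of the bottom row, $L_1,\dots,L_N$ the leftmost vertices of the rows, and $R_1,\dots,R_N$ the rightmost vertices of the rows, each family numbered from left to right (so $L_1$ is the leftmost vertex of the bottom row and $R_1$ the rightmost vertex of the top row). A TFPL of size $N$ is a subgraph $f$ of $G^N$ (a set of edges) such that each $L_i$ and each $R_i$ has degree $0$ or $1$, each $B_i$ has degree $1$, every other vertex has degree $2$, and no path of $f$ joins two vertices $L_i,L_j$ or two vertices $R_i,R_j$. An oriented TFPL is a TFPL together with an orientation of each of its edges such that every vertex of degree $2$ has one incoming and one outgoing edge, the edges at the $L_i$ are oriented away from $L_i$, and the edges at the $R_i$ are oriented into $R_i$. For words $u,v,w\in\{0,1\}^N$,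 an oriented TFPL has boundary $(u,v;w)$ if for all $i$: $u_i=1$ iff $L_i$ has degree $1$; $v_i=0$ iff $R_i$ has degree $1$; $w_i=1$ if $B_i$ has in-degree $1$ and $w_i=0$ if $B_i$ has out-degree $1$. $G^N_o(u,w)$ is the induced subgraph of $G^N$ obtained by deleting all $R_i$, all $B_i$ with $w_i=0$, and all $L_i$ with $u_i=0$. $G^N_e(v,w)$ is the induced subgraph of $G^N$ obtained by deleting all $L_i$, all $B_i$ with $w_i=1$, and all $R_i$ with $v_i=1$. -}

module Defs where

open import Data.Bool using (Bool; T; not; _∧_; _∨_)
open import Data.Bool.Properties using (∨-comm; T-∧; T-∨)
open import Data.Fin using (Fin; zero; toℕ; fromℕ; fromℕ<; opposite)
open import Data.Fin.Patterns using (0F; 1F)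
open import Data.Fin.Properties using (toℕ<n; toℕ-fromℕ)
open import Data.Integer as ℤ using (ℤ; +_; ∣_∣)
open import Data.List using (List; length; filterᵇ; concatMap; map; allFin; head; last)
open import Data.List.Relation.Unary.Linked using (Linked)
open import Data.List.Relation.Unary.Unique.Propositional using (Unique)
open import Data.Maybe using (just)
open import Data.Nat using (ℕ; suc; _+_; _*_; _%_; _<_; s≤s; s≤s⁻¹; _≟_)
open import Data.Nat.Properties using (*-monoʳ-≤; m≤n⇒m≤1+n)
open import Data.Product using (Σ-syntax; ∃-syntax; _×_; _,_; proj₁; proj₂)
open import Data.Sum using (_⊎_; inj₁; inj₂)
open import Data.Vec using (Vec; lookup)
open import Function using (_⇔_; Equivalence)
open import Level using (0ℓ)
open import Relation.Binary using (Rel)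
open import Relation.Binary.PropositionalEquality using (_≡_; _≢_; sym; subst)
open import Relation.Nullary using (¬_)
open import Relation.Nullary.Decidable using (⌊_⌋)
open import Relation.Unary using (Pred)

Word : ℕ → Set
Word N = Vec (Fin 2) N

Point : Set
Point = ℤ × ℤ

LatticeAdjacent : Rel Point 0ℓ
LatticeAdjacent (x , y) (x′ , y′) = ∣ x ℤ.- x′ ∣ + ∣ y ℤ.- y′ ∣ ≡ 1

colour : Point → ℕ
colour (x , y) = ∣ x ℤ.+ y ∣ % 2

-- Row r (counted from 0, top to bottom) has 2(r+1)+1 vertices, and the
-- columns of a row are counted from 0, left to right.
Vertex : ℕ → Set
Vertex N = Σ[ r ∈ Fin N ] Fin (3 + 2 * toℕ r)

module _ {N : ℕ} where

  -- The rows are centred on the vertical axis, so row r occupies the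
  -- abscissae -(r+1), …, r+1.
  position : Vertex N → Point
  position (r , c) = + toℕ c ℤ.- + suc (toℕ r) , ℤ.- (+ suc (toℕ r))

  Adjacent : Rel (Vertex N) 0ℓ
  Adjacent a b = LatticeAdjacent (position a) (position b)

  leftmost rightmost : Fin N → Vertex N
  leftmost  r = r , zero
  rightmost r = r , fromℕ (2 + 2 * toℕ r)

  isOdd isEven : Vertex N → Bool
  isOdd  a = ⌊ colour (position a) ≟ colour (position (leftmost (proj₁ a))) ⌋
  isEven a = not (isOdd a)

  vertices : List (Vertex N)
  vertices = concatMap (λ r → map (r ,_) (allFin _)) (allFin N)

  count : (Vertex N → Bool) → ℕ
  count p = length (filterᵇ p vertices)

-- Indices are shifted to start from 0.  Going from left to right visits the
-- left boundary from the bottom row up and the right boundary from the top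
-- row down.
L R : ∀ {N} → Fin N → Vertex N
L i = leftmost (opposite i)
R i = rightmost i

-- The even vertices of the bottom row are those in columns 1, 3, …, 2N-1.
B : ∀ {N} → Fin N → Vertex N
B {suc n} i = fromℕ n , fromℕ< 1+2i<width
  where
  1+2i<width : 1 + 2 * toℕ i < 3 + 2 * toℕ (fromℕ n)
  1+2i<width = subst (λ m → 1 + 2 * toℕ i < 3 + 2 * m) (sym (toℕ-fromℕ n))
    (s≤s (s≤s (m≤n⇒m≤1+n (*-monoʳ-≤ 2 (s≤s⁻¹ (toℕ<n i))))))

-- A set of (undirected) edges of the graph, as a symmetric Boolean relation.
record EdgeSet (N : ℕ) : Set where
  field
    edge     : Vertex N → Vertex N → Bool
    edge-sym : ∀ a b → edge a b ≡ edge b a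
    edge-adj : ∀ a b → T (edge a b) → Adjacent a b

  Edge : Rel (Vertex N) 0ℓ
  Edge a b = T (edge a b)

  degree : Vertex N → ℕ
  degree a = count (edge a)

  Path : Rel (Vertex N) 0ℓ
  Path a b = ∃[ as ] (Linked Edge as × Unique as × head as ≡ just a × last as ≡ just b)

open EdgeSet public

module _ {N : ℕ} where

  infix 4 _≈ᴱ_

  _≈ᴱ_ : Rel (EdgeSet N) 0ℓ
  f ≈ᴱ g = ∀ a b → edge f a b ≡ edge g a b

  Disjoint : Rel (EdgeSet N) 0ℓ
  Disjoint f g = ∀ a b → ¬ (Edge f a b × Edge g a b)

  -- M is a perfect matching of the subgraph induced by the vertex set S.
  record IsPerfectMatching (S : Pred (Vertex N) 0ℓ) (M : EdgeSet N) : Set where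
    field
      within : ∀ a b → Edge M a b → S a × S b
      covers : ∀ a → S a → degree M a ≡ 1

  record IsTFPL (f : EdgeSet N) : Set where
    field
      degree-L     : ∀ i → degree f (L i) ≡ 0 ⊎ degree f (L i) ≡ 1
      degree-R     : ∀ i → degree f (R i) ≡ 0 ⊎ degree f (R i) ≡ 1
      degree-B     : ∀ i → degree f (B i) ≡ 1
      degree-other : ∀ a → (∀ i → a ≢ L i) → (∀ i → a ≢ R i) → (∀ i → a ≢ B i) →
                     degree f a ≡ 2
      no-path-L    : ∀ i j → i ≢ j → ¬ Path f (L i) (L j)
      no-path-R    : ∀ i j → i ≢ j → ¬ Path f (R i) (R j)

record OrientedTFPL (N : ℕ) : Set where
  field
    edges  : EdgeSet N
    isTFPL : IsTFPL edges

    -- arc a b holds when {a, b} is an edge oriented from a to b.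
    arc         : Vertex N → Vertex N → Bool
    arc⇒edge    : ∀ a b → T (arc a b) → Edge edges a b
    edge⇒arc    : ∀ a b → Edge edges a b → T (arc a b) ⊎ T (arc b a)
    arc-antisym : ∀ a b → ¬ (T (arc a b) × T (arc b a))

  outDegree : Vertex N → ℕ
  outDegree a = count (arc a)

  inDegree : Vertex N → ℕ
  inDegree a = count (λ b → arc b a)

  field
    balanced : ∀ a → degree edges a ≡ 2 → inDegree a ≡ 1 × outDegree a ≡ 1
    from-L   : ∀ i b → Edge edges (L i) b → T (arc (L i) b)
    into-R   : ∀ i b → Edge edges (R i) b → T (arc b (R i))

open OrientedTFPL public

module _ {N : ℕ} where

  record HasBoundary (u v w : Word N) (f : OrientedTFPL N) : Set where
    field
      boundary-u  : ∀ i → lookup u i ≡ 1F ⇔ degree (edges f) (L i) ≡ 1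
      boundary-v  : ∀ i → lookup v i ≡ 0F ⇔ degree (edges f) (R i) ≡ 1
      boundary-w₁ : ∀ i → inDegree f (B i) ≡ 1 → lookup w i ≡ 1F
      boundary-w₀ : ∀ i → outDegree f (B i) ≡ 1 → lookup w i ≡ 0F

  -- The edges of f oriented from a vertex satisfying p to one satisfying q.
  edgesFromTo : (p q : Vertex N → Bool) → OrientedTFPL N → EdgeSet N
  edgesFromTo p q f = record
    { edge     = λ a b → directed a b ∨ directed b a
    ; edge-sym = λ a b → ∨-comm (directed a b) (directed b a)
    ; edge-adj = λ a b e → edge-adj (edges f) a b (⇒edge a b (Equivalence.to T-∨ e))
    }
    where
    directed : Vertex N → Vertex N → Bool
    directed a b = arc f a b ∧ (p a ∧ q b)

    directed⇒edge : ∀ a b → T (directed a b) → Edge (edges f) a b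
    directed⇒edge a b d = arc⇒edge f a b (proj₁ (Equivalence.to T-∧ d))

    ⇒edge : ∀ a b → T (directed a b) ⊎ T (directed b a) → Edge (edges f) a b
    ⇒edge a b (inj₁ d) = directed⇒edge a b d
    ⇒edge a b (inj₂ d) = subst T (edge-sym (edges f) b a) (directed⇒edge b a d)

  Mₒ Mₑ : OrientedTFPL N → EdgeSet N
  Mₒ = edgesFromTo isOdd isEven
  Mₑ = edgesFromTo isEven isOdd

  -- Induced subgraphs are represented by their vertex sets.
  Gₒ : (u w : Word N) → Pred (Vertex N) 0ℓ
  Gₒ u w a = (∀ i → a ≢ R i)
           × (∀ i → lookup w i ≡ 0F → a ≢ B i)
           × (∀ i → lookup u i ≡ 0F → a ≢ L i)

  Gₑ : (v w : Word N) → Pred (Vertex N) 0ℓ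
  Gₑ v w a = (∀ i → a ≢ L i)
           × (∀ i → lookup w i ≡ 1F → a ≢ B i)
           × (∀ i → lookup v i ≡ 1F → a ≢ R i)

  module _ (u v w : Word N) where

    BoundedTFPL : Set
    BoundedTFPL = Σ[ f ∈ OrientedTFPL N ] HasBoundary u v w f

    record IsMatchingPair (M : EdgeSet N × EdgeSet N) : Set where
      field
        matchingₒ : IsPerfectMatching (Gₒ u w) (proj₁ M)
        matchingₑ : IsPerfectMatching (Gₑ v w) (proj₂ M)
        disjoint  : Disjoint (proj₁ M) (proj₂ M)

    MatchingPair : Set
    MatchingPair = Σ[ M ∈ EdgeSet N × EdgeSet N ] IsMatchingPair M

  module _ {u v w : Word N} where

    infix 4 _≈ᵀ_ _≈ᴹ_

    _≈ᵀ_ : Rel (BoundedTFPL u v w) 0ℓ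
    (f , _) ≈ᵀ (g , _) = (edges f ≈ᴱ edges g) × (∀ a b → arc f a b ≡ arc g a b)

    _≈ᴹ_ : Rel (MatchingPair u v w) 0ℓ
    ((M , M′) , _) ≈ᴹ ((K , K′) , _) = (M ≈ᴱ K) × (M′ ≈ᴱ K′)

    toMatchings : BoundedTFPL u v w → EdgeSet N × EdgeSet N
    toMatchings (f , _) = Mₒ f , Mₑ f

{-# OPTIONS --safe #-}
-- At an odd vertex Mₒ collects the outgoing and Mₑ the incoming edges, at an
-- even vertex the other way round. Hence the degree conditions of an oriented
-- TFPL at a vertex say exactly which of the two matchings cover it. The
-- condition on paths is automatic: all in- and outdegrees are at most 1, so a
-- path is oriented consistently, and it can neither start and end at sources
-- L i, L j nor start and end at sinks R i, R j.
module Submission where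

open import Data.Bool using (Bool; true; false; T; T?; not; _∧_; _∨_; if_then_else_)
open import Data.Bool.Properties using (∧-zeroʳ; ∧-identityʳ; ∨-identityʳ; if-cong; T-∨)
open import Data.Empty using (⊥-elim)
open import Data.Fin using (Fin; toℕ; opposite)
import Data.Fin as Fin
open import Data.Fin.Patterns using (0F; 1F)
open import Data.Fin.Properties
  using (toℕ<n; toℕ-fromℕ; toℕ-fromℕ<; toℕ-injective; opposite-involutive; any?)
open import Data.Integer as ℤ using (∣_∣; +_; -[1+_])
open import Data.Integer.Properties using ([1+m]⊖[1+n]≡m⊖n; ∣-i∣≡∣i∣)
open import Data.List using (List; []; _∷_; length; filterᵇ; last; allFin; map)
open import Data.List.Membership.Propositional using (_∈_; lose)
open import Data.List.Membership.Propositional.Properties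
  using (∈-concatMap⁺; ∈-map⁺; ∈-allFin; ∈-filter⁺; ∈-filter⁻)
open import Data.List.Relation.Unary.All using (_∷_)
open import Data.List.Relation.Unary.AllPairs using (_∷_)
open import Data.List.Relation.Unary.Any using (here)
open import Data.List.Relation.Unary.Linked using (Linked; _∷_)
open import Data.List.Relation.Unary.Unique.Propositional using (Unique)
open import Data.Maybe using (just)
open import Data.Maybe.Properties using (just-injective)
open import Data.Nat using (ℕ; zero; suc; _+_; _*_; _%_; _≤_; _<_; s≤s; s≤s⁻¹; _≟_; parity)
open import Data.Nat.Properties
  using (+-suc; +-identityʳ; suc-injective; *-cancelˡ-≡; *-monoʳ-≤; m<n⇒m<1+n)
open import Data.Parity using (Parity; 0ℙ; 1ℙ)
import Data.Parity as ℙ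
import Data.Parity.Properties as ℙ
open import Data.Product using (Σ-syntax; ∃-syntax; _×_; _,_; proj₁; proj₂)
open import Data.Product.Properties using (≡-dec)
open import Data.Sum using (_⊎_; inj₁; inj₂; swap; [_,_]′)
open import Data.Vec using (lookup)
open import Function using (id; mk⇔; Equivalence)
open import Function.Definitions using (Bijective)
open import Level using (0ℓ)
open import Relation.Binary using (Rel; Symmetric; DecidableEquality)
open import Relation.Binary.PropositionalEquality
  using (_≡_; _≢_; refl; sym; trans; cong; cong₂; subst; module ≡-Reasoning)
open import Relation.Nullary using (¬_; yes; no; contradiction)
open import Relation.Nullary.Decidable using (⌊_⌋)
import Algebra.Properties.CommutativeSemigroup as CommutativeSemigroupProperties

open import Defs

-- Booleans and letters of words

≡true⊎≡false : ∀ b → b ≡ true ⊎ b ≡ false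
≡true⊎≡false true  = inj₁ refl
≡true⊎≡false false = inj₂ refl

T⇒≡ : ∀ {x y} → (T x → T y) → (T y → T x) → x ≡ y
T⇒≡ {true}  {true}  _ _ = refl
T⇒≡ {true}  {false} f _ = ⊥-elim (f _)
T⇒≡ {false} {true}  _ g = ⊥-elim (g _)
T⇒≡ {false} {false} _ _ = refl

≡0F⊎≡1F : (x : Fin 2) → x ≡ 0F ⊎ x ≡ 1F
≡0F⊎≡1F 0F = inj₁ refl
≡0F⊎≡1F 1F = inj₂ refl

≢0F⇒≡1F : {x : Fin 2} → x ≢ 0F → x ≡ 1F
≢0F⇒≡1F {x} x≢0 = [ (λ x≡0 → contradiction x≡0 x≢0) , id ]′ (≡0F⊎≡1F x)

≢1F⇒≡0F : {x : Fin 2} → x ≢ 1F → x ≡ 0F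
≢1F⇒≡0F {x} x≢1 = [ id , (λ x≡1 → contradiction x≡1 x≢1) ]′ (≡0F⊎≡1F x)

≡1F⇒≢0F : {x : Fin 2} → x ≡ 1F → x ≢ 0F
≡1F⇒≢0F refl ()

-- Sizes of filtered lists

module _ {A : Set} where

  length-filterᵇ-cong : {p q : A → Bool} → (∀ a → p a ≡ q a) →
    ∀ xs → length (filterᵇ p xs) ≡ length (filterᵇ q xs)
  length-filterᵇ-cong p≗q [] = refl
  length-filterᵇ-cong {p} {q} p≗q (x ∷ xs) with p x | q x | p≗q x
  ... | true  | _ | refl = cong suc (length-filterᵇ-cong p≗q xs)
  ... | false | _ | refl = length-filterᵇ-cong p≗q xs

  -- This gives both additivity facts about degrees: out plus in for an orientation, and first plus
  -- second for disjoint matchings.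
  length-filterᵇ-∨ : {p q : A → Bool} → (∀ a → ¬ (T (p a) × T (q a))) →
    ∀ xs → length (filterᵇ (λ a → p a ∨ q a) xs) ≡
           length (filterᵇ p xs) + length (filterᵇ q xs)
  length-filterᵇ-∨ p∩q≡∅ [] = refl
  length-filterᵇ-∨ {p} {q} p∩q≡∅ (x ∷ xs) with p x | q x | p∩q≡∅ x
  ... | true  | true  | ¬both = contradiction (_ , _) ¬both
  ... | true  | false | _     = cong suc (length-filterᵇ-∨ p∩q≡∅ xs)
  ... | false | true  | _     =
    trans (cong suc (length-filterᵇ-∨ p∩q≡∅ xs)) (sym (+-suc _ _))
  ... | false | false | _     = length-filterᵇ-∨ p∩q≡∅ xs

  ∈-singleton : ∀ {xs : List A} {a b} → length xs ≡ 1 → a ∈ xs → b ∈ xs → a ≡ b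
  ∈-singleton {_ ∷ []} _ (here refl) (here refl) = refl

  ∈⇒length≢0 : ∀ {xs : List A} {a} → a ∈ xs → length xs ≢ 0
  ∈⇒length≢0 {_ ∷ _} _ ()

-- Paths along an orientation

module _ {A : Set} {E D : Rel A 0ℓ} (E⇒D : ∀ {a b} → E a b → D a b ⊎ D b a)
  (D-injective : ∀ {a b c} → D a b → D c b → a ≡ c) where

  -- Once a path has entered `b` along an arc, the next edge must leave `b` along its arc: a
  -- reversed edge would be a second arc into `b`, so its other end would be `a`, which the path
  -- cannot revisit.
  path-follows-orientation : ∀ {a b z as} → D a b → Linked E (b ∷ as) → Unique (a ∷ b ∷ as) →
    last (b ∷ as) ≡ just z → ∃[ y ] D y z
  path-follows-orientation {as = []} ab _ _ refl = _ , ab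
  path-follows-orientation {as = _ ∷ _} ab (e ∷ es) ((_ ∷ a≢c ∷ _) ∷ unique) eq with E⇒D e
  ... | inj₁ bc = path-follows-orientation bc es unique eq
  ... | inj₂ cb = contradiction (D-injective ab cb) a≢c

  -- The first edge leaves `s` along its arc, so by induction the last edge is an arc into `t`,
  -- which has none.
  no-path-from-source : ∀ {s t as} → (∀ {b} → E s b → D s b) → (∀ {b} → ¬ D b t) → s ≢ t →
    Linked E (s ∷ as) → Unique (s ∷ as) → ¬ last (s ∷ as) ≡ just t
  no-path-from-source {as = []} _ _ s≢t _ _ eq = s≢t (just-injective eq)
  no-path-from-source {as = _ ∷ _} from-s to-t _ (e ∷ es) unique eq =
    to-t (proj₂ (path-follows-orientation (from-s e) es unique eq))

-- The two-colouring of the graph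

-- Two flips cancel. This serves the inductive step for `⊖`, which strips a successor from each
-- side, and the sum of two negative integers.
parity-suc+suc : ∀ m n → parity (suc m) ℙ.+ parity (suc n) ≡ parity m ℙ.+ parity n
parity-suc+suc m n = begin
  parity (suc m) ℙ.+ parity (suc n) ≡⟨ ℙ.+-homo-+ (suc m) (suc n) ⟨
  parity (suc (m + suc n))          ≡⟨ cong (λ k → parity (suc k)) (+-suc m n) ⟩
  parity (m + n)                    ≡⟨ ℙ.+-homo-+ m n ⟩
  parity m ℙ.+ parity n             ∎
  where open ≡-Reasoning

parity-⊖ : ∀ m n → parity ∣ m ℤ.⊖ n ∣ ≡ parity m ℙ.+ parity n
parity-⊖ zero    zero    = refl
parity-⊖ zero    (suc n) = refl
parity-⊖ (suc m) zero    = sym (ℙ.+-identityʳ _)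
parity-⊖ (suc m) (suc n) = begin
  parity ∣ suc m ℤ.⊖ suc n ∣        ≡⟨ cong (λ i → parity ∣ i ∣) ([1+m]⊖[1+n]≡m⊖n m n) ⟩
  parity ∣ m ℤ.⊖ n ∣                ≡⟨ parity-⊖ m n ⟩
  parity m ℙ.+ parity n             ≡⟨ parity-suc+suc m n ⟨
  parity (suc m) ℙ.+ parity (suc n) ∎
  where open ≡-Reasoning

parity-∣+∣ : ∀ i j → parity ∣ i ℤ.+ j ∣ ≡ parity ∣ i ∣ ℙ.+ parity ∣ j ∣
parity-∣+∣ (+ m)    (+ n)    = ℙ.+-homo-+ m n
parity-∣+∣ (+ m)    -[1+ n ] = parity-⊖ m (suc n)
parity-∣+∣ -[1+ m ] (+ n)    = trans (parity-⊖ n (suc m)) (ℙ.+-comm (parity n) _)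
-- The absolute value is `suc (suc (m + n))`, whose parity computes to that of `m + n`.
parity-∣+∣ -[1+ m ] -[1+ n ] = trans (ℙ.+-homo-+ m n) (sym (parity-suc+suc m n))

parity-∣-∣ : ∀ i j → parity ∣ i ℤ.- j ∣ ≡ parity ∣ i ∣ ℙ.+ parity ∣ j ∣
parity-∣-∣ i j =
  trans (parity-∣+∣ i (ℤ.- j)) (cong (λ k → parity ∣ i ∣ ℙ.+ parity k) (∣-i∣≡∣i∣ j))

-- The residue belonging to a parity. `colour` is a remainder modulo 2, while the sums below are
-- computed in the group of parities.
bit : Parity → ℕ
bit 0ℙ = 0
bit 1ℙ = 1

%2≡bit-parity : ∀ n → n % 2 ≡ bit (parity n)
%2≡bit-parity 0             = refl
%2≡bit-parity 1             = refl
%2≡bit-parity (suc (suc n)) = %2≡bit-parity n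

isZero : Parity → Bool
isZero 0ℙ = true
isZero 1ℙ = false

bit≟0 : ∀ p → ⌊ bit p ≟ 0 ⌋ ≡ isZero p
bit≟0 0ℙ = refl
bit≟0 1ℙ = refl

isZero-not : ∀ p q → p ℙ.+ q ≡ 1ℙ → isZero q ≡ not (isZero p)
isZero-not 0ℙ 1ℙ _ = refl
isZero-not 1ℙ 0ℙ _ = refl

parity-2* : ∀ n → parity (2 * n) ≡ 0ℙ
parity-2* n = ℙ.*-homo-* 2 n

module _ {N : ℕ} where

  column : Vertex N → ℕ
  column a = toℕ (proj₂ a)

  -- The centring of row `r` shifts the abscissa by `suc r`, and the ordinate has the same absolute
  -- value. The two contributions cancel modulo 2, so the colour depends on the column alone.
  parity-position : ∀ a → let (x , y) = position a in
    parity ∣ x ∣ ℙ.+ parity ∣ y ∣ ≡ parity (column a)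
  parity-position (r , c) = begin
    parity ∣ + toℕ c ℤ.- + s ∣ ℙ.+ parity s   ≡⟨ cong (ℙ._+ parity s) (parity-∣-∣ (+ toℕ c) (+ s)) ⟩
    parity (toℕ c) ℙ.+ parity s ℙ.+ parity s  ≡⟨ ℙ.+-assoc (parity (toℕ c)) (parity s) (parity s) ⟩
    parity (toℕ c) ℙ.+ (parity s ℙ.+ parity s) ≡⟨ cong (parity (toℕ c) ℙ.+_) (ℙ.p+p≡0ℙ (parity s)) ⟩
    parity (toℕ c) ℙ.+ 0ℙ                     ≡⟨ ℙ.+-identityʳ _ ⟩
    parity (toℕ c)                            ∎
    where
    open ≡-Reasoning
    s : ℕ
    s = suc (toℕ r)

  colour-position : ∀ a → colour (position a) ≡ bit (parity (column a))
  colour-position a = begin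
    ∣ x ℤ.+ y ∣ % 2                     ≡⟨ %2≡bit-parity ∣ x ℤ.+ y ∣ ⟩
    bit (parity ∣ x ℤ.+ y ∣)            ≡⟨ cong bit (parity-∣+∣ x y) ⟩
    bit (parity ∣ x ∣ ℙ.+ parity ∣ y ∣) ≡⟨ cong bit (parity-position a) ⟩
    bit (parity (column a))             ∎
    where
    open ≡-Reasoning
    x = proj₁ (position a)
    y = proj₂ (position a)

  -- The reference vertex of each row lies in column 0, so `isOdd` compares with the residue 0 in
  -- every row.
  isOdd-column : ∀ a → isOdd a ≡ isZero (parity (column a))
  isOdd-column a = trans
    (cong₂ (λ m n → ⌊ m ≟ n ⌋) (colour-position a) (colour-position (leftmost (proj₁ a))))
    (bit≟0 (parity (column a)))

  -- Modulo 2 the lattice distance is the sum of all four coordinates, hence of the two columns; for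
  -- neighbours it is 1.
  isOdd-adjacent : ∀ a b → Adjacent a b → isOdd b ≡ not (isOdd a)
  isOdd-adjacent a b adj = begin
    isOdd b                          ≡⟨ isOdd-column b ⟩
    isZero (parity (column b))       ≡⟨ isZero-not (parity (column a)) (parity (column b)) sum≡1 ⟩
    not (isZero (parity (column a))) ≡⟨ cong not (isOdd-column a) ⟨
    not (isOdd a)                    ∎
    where
    open ≡-Reasoning
    open CommutativeSemigroupProperties ℙ.+-commutativeSemigroup using (interchange)
    x = proj₁ (position a)
    y = proj₂ (position a)
    x′ = proj₁ (position b)
    y′ = proj₂ (position b)
    sum≡1 : parity (column a) ℙ.+ parity (column b) ≡ 1ℙ
    sum≡1 = begin
      parity (column a) ℙ.+ parity (column b)
        ≡⟨ cong₂ ℙ._+_ (parity-position a) (parity-position b) ⟨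
      (parity ∣ x ∣ ℙ.+ parity ∣ y ∣) ℙ.+ (parity ∣ x′ ∣ ℙ.+ parity ∣ y′ ∣)
        ≡⟨ interchange (parity ∣ x ∣) (parity ∣ y ∣) (parity ∣ x′ ∣) (parity ∣ y′ ∣) ⟩
      (parity ∣ x ∣ ℙ.+ parity ∣ x′ ∣) ℙ.+ (parity ∣ y ∣ ℙ.+ parity ∣ y′ ∣)
        ≡⟨ cong₂ ℙ._+_ (parity-∣-∣ x x′) (parity-∣-∣ y y′) ⟨
      parity ∣ x ℤ.- x′ ∣ ℙ.+ parity ∣ y ℤ.- y′ ∣
        ≡⟨ ℙ.+-homo-+ ∣ x ℤ.- x′ ∣ ∣ y ℤ.- y′ ∣ ⟨
      parity (∣ x ℤ.- x′ ∣ + ∣ y ℤ.- y′ ∣)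
        ≡⟨ cong parity adj ⟩
      1ℙ ∎

  odd-adjacent-even : ∀ a b → Adjacent a b → isOdd a ≡ true → isOdd b ≡ false
  odd-adjacent-even a b adj odd = trans (isOdd-adjacent a b adj) (cong not odd)

  even-adjacent-odd : ∀ a b → Adjacent a b → isOdd a ≡ false → isOdd b ≡ true
  even-adjacent-odd a b adj even = trans (isOdd-adjacent a b adj) (cong not even)

  column-R : (i : Fin N) → column (R i) ≡ 2 + 2 * toℕ i
  column-R i = toℕ-fromℕ (2 + 2 * toℕ i)

column-B : ∀ {N} (i : Fin N) → column (B i) ≡ 1 + 2 * toℕ i
-- The bound is an irrelevant argument of `fromℕ<`, so this proof may differ from the one inside
-- `B`.
column-B {suc n} i = toℕ-fromℕ< (m<n⇒m<1+n (subst (λ m → 1 + 2 * toℕ i < 2 + 2 * m)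
  (sym (toℕ-fromℕ n)) (s≤s (s≤s (*-monoʳ-≤ 2 (s≤s⁻¹ (toℕ<n i)))))))

module _ {N : ℕ} where

  isOdd-L : (i : Fin N) → isOdd (L i) ≡ true
  isOdd-L i = isOdd-column (L i)

  isOdd-R : (i : Fin N) → isOdd (R i) ≡ true
  isOdd-R i = trans (isOdd-column (R i))
    (cong isZero (trans (cong parity (column-R i)) (parity-2* (toℕ i))))

  isOdd-B : (i : Fin N) → isOdd (B i) ≡ false
  isOdd-B i = trans (isOdd-column (B i)) (cong isZero (begin
    parity (column (B i))         ≡⟨ cong parity (column-B i) ⟩
    parity (1 + 2 * toℕ i)        ≡⟨ ℙ.+-homo-+ 1 (2 * toℕ i) ⟩
    1ℙ ℙ.+ parity (2 * toℕ i)     ≡⟨ cong (1ℙ ℙ.+_) (parity-2* (toℕ i)) ⟩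
    1ℙ                            ∎))
    where open ≡-Reasoning

  -- Boundary vertices

  odd≢even : {a b : Vertex N} → isOdd a ≡ true → isOdd b ≡ false → a ≢ b
  odd≢even odd even refl = contradiction (trans (sym odd) even) λ ()

  -- Both vertices are odd, so colours cannot separate them; the columns 0 and `2 + 2 * toℕ j` do.
  L≢R : (i j : Fin N) → L i ≢ R j
  L≢R i j eq = contradiction (trans (cong column eq) (column-R j)) λ ()

  L≢B : (i j : Fin N) → L i ≢ B j
  L≢B i j = odd≢even (isOdd-L i) (isOdd-B j)

  R≢B : (i j : Fin N) → R i ≢ B j
  R≢B i j = odd≢even (isOdd-R i) (isOdd-B j)

  L-injective : (i j : Fin N) → L i ≡ L j → i ≡ j
  L-injective i j eq = begin
    i                     ≡⟨ opposite-involutive i ⟨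
    opposite (opposite i) ≡⟨ cong (λ a → opposite (proj₁ a)) eq ⟩
    opposite (opposite j) ≡⟨ opposite-involutive j ⟩
    j                     ∎
    where open ≡-Reasoning

  R-injective : (i j : Fin N) → R i ≡ R j → i ≡ j
  R-injective i j = cong proj₁

  B-injective : (i j : Fin N) → B i ≡ B j → i ≡ j
  B-injective i j eq = toℕ-injective (*-cancelˡ-≡ _ _ 2 (suc-injective
    (trans (sym (column-B i)) (trans (cong column eq) (column-B j)))))

  -- The cases mirror the degree conditions of a TFPL, with `other` for the vertices of degree 2.
  data Kind : Vertex N → Set where
    left   : ∀ i → Kind (L i)
    right  : ∀ i → Kind (R i)
    bottom : ∀ i → Kind (B i)
    other  : ∀ {a} → (∀ i → a ≢ L i) → (∀ i → a ≢ R i) → (∀ i → a ≢ B i) → Kind a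

  _≟ⱽ_ : DecidableEquality (Vertex N)
  _≟ⱽ_ = ≡-dec Fin._≟_ Fin._≟_

  kind : ∀ a → Kind a
  kind a with any? (λ i → a ≟ⱽ L i) | any? (λ i → a ≟ⱽ R i) | any? (λ i → a ≟ⱽ B i)
  ... | yes (i , refl) | _              | _              = left i
  ... | no _           | yes (i , refl) | _              = right i
  ... | no _           | no _           | yes (i , refl) = bottom i
  ... | no ¬L          | no ¬R          | no ¬B          =
    other (λ i eq → ¬L (i , eq)) (λ i eq → ¬R (i , eq)) (λ i eq → ¬B (i , eq))

  module _ (u w : Word N) where

    -- The boundary families are disjoint and injectively numbered, so only the letter at `i` could
    -- cause the deletion of `L i`. The three membership lemmas that follow rest on the same fact.
    L∈Gₒ : ∀ i → lookup u i ≡ 1F → Gₒ u w (L i)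
    L∈Gₒ i uᵢ≡1 = L≢R i , (λ j _ → L≢B i j) ,
      λ j uⱼ≡0 eq → ≡1F⇒≢0F uᵢ≡1 (trans (cong (lookup u) (L-injective i j eq)) uⱼ≡0)

    B∈Gₒ : ∀ i → lookup w i ≡ 1F → Gₒ u w (B i)
    B∈Gₒ i wᵢ≡1 = (λ j eq → R≢B j i (sym eq)) ,
      (λ j wⱼ≡0 eq → ≡1F⇒≢0F wᵢ≡1 (trans (cong (lookup w) (B-injective i j eq)) wⱼ≡0)) ,
      λ j _ eq → L≢B j i (sym eq)

  module _ (v w : Word N) where

    R∈Gₑ : ∀ i → lookup v i ≡ 0F → Gₑ v w (R i)
    R∈Gₑ i vᵢ≡0 = (λ j eq → L≢R j i (sym eq)) , (λ j _ → R≢B i j) ,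
      λ j vⱼ≡1 eq → ≡1F⇒≢0F vⱼ≡1 (trans (cong (lookup v) (sym (R-injective i j eq))) vᵢ≡0)

    B∈Gₑ : ∀ i → lookup w i ≡ 0F → Gₑ v w (B i)
    B∈Gₑ i wᵢ≡0 = (λ j eq → L≢B j i (sym eq)) ,
      (λ j wⱼ≡1 eq → ≡1F⇒≢0F wⱼ≡1 (trans (cong (lookup w) (sym (B-injective i j eq))) wᵢ≡0)) ,
      λ j _ eq → R≢B j i (sym eq)

  -- Counting vertices

  ∈-vertices : ∀ a → a ∈ vertices {N}
  ∈-vertices (r , c) = ∈-concatMap⁺ (λ r → map (r ,_) (allFin _))
    (lose (∈-allFin r) (∈-map⁺ (r ,_) (∈-allFin c)))

  module _ (p : Vertex N → Bool) where

    ∈-counted : ∀ {a} → T (p a) → a ∈ filterᵇ p vertices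
    ∈-counted {a} = ∈-filter⁺ (λ b → T? (p b)) {xs = vertices} (∈-vertices a)

    count≡0⊎∃ : count p ≡ 0 ⊎ ∃[ a ] T (p a)
    -- The filtered list is generalised, keeping only that its members satisfy `p`, so that it can
    -- be matched on.
    count≡0⊎∃ = by-cases (filterᵇ p vertices)
      (λ a∈ → proj₂ (∈-filter⁻ (λ b → T? (p b)) {xs = vertices} a∈))
      where
      by-cases : ∀ as → (∀ {a} → a ∈ as → T (p a)) → length as ≡ 0 ⊎ ∃[ a ] T (p a)
      by-cases []      _   = inj₁ refl
      by-cases (a ∷ _) sat = inj₂ (a , sat (here refl))

    count≡0 : (∀ a → ¬ T (p a)) → count p ≡ 0
    count≡0 none with count≡0⊎∃
    ... | inj₁ eq       = eq
    ... | inj₂ (a , pa) = contradiction pa (none a)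

    count≡1⇒∃ : count p ≡ 1 → ∃[ a ] T (p a)
    count≡1⇒∃ count≡1 with count≡0⊎∃
    ... | inj₁ count≡0 = contradiction (trans (sym count≡0) count≡1) λ ()
    ... | inj₂ found   = found

    count≡1⇒unique : ∀ {a b} → count p ≡ 1 → T (p a) → T (p b) → a ≡ b
    count≡1⇒unique count≡1 pa pb = ∈-singleton count≡1 (∈-counted pa) (∈-counted pb)

    count≢0 : ∀ {a} → T (p a) → count p ≢ 0
    count≢0 pa count≡0 = contradiction count≡0 (∈⇒length≢0 (∈-counted pa))

  count-cong : {p q : Vertex N → Bool} → (∀ a → p a ≡ q a) → count p ≡ count q
  count-cong p≗q = length-filterᵇ-cong p≗q vertices

  count-∨ : {p q : Vertex N → Bool} → (∀ a → ¬ (T (p a) × T (q a))) →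
    count (λ a → p a ∨ q a) ≡ count p + count q
  count-∨ p∩q≡∅ = length-filterᵇ-∨ p∩q≡∅ vertices

  Edge-sym : (M : EdgeSet N) → Symmetric (Edge M)
  Edge-sym M {a} {b} = subst T (edge-sym M a b)

m+n≡1⇒ : ∀ m n → m + n ≡ 1 → (m ≡ 1 × n ≡ 0) ⊎ (m ≡ 0 × n ≡ 1)
m+n≡1⇒ zero       n    eq = inj₂ (refl , eq)
m+n≡1⇒ (suc zero) zero eq = inj₁ (refl , refl)

-- From oriented TFPLs to matchings

module _ {N : ℕ} (f : OrientedTFPL N) where

  arc-adjacent : ∀ a b → T (arc f a b) → Adjacent a b
  arc-adjacent a b ab = edge-adj (edges f) a b (arc⇒edge f a b ab)

  edge≡arc∨arc : ∀ a b → edge (edges f) a b ≡ arc f a b ∨ arc f b a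
  edge≡arc∨arc a b = T⇒≡
    (λ e → Equivalence.from T-∨ (edge⇒arc f a b e))
    (λ e → [ arc⇒edge f a b , (λ ba → Edge-sym (edges f) (arc⇒edge f b a ba)) ]′
      (Equivalence.to T-∨ e))

  degree≡out+in : ∀ a → degree (edges f) a ≡ outDegree f a + inDegree f a
  degree≡out+in a = trans (count-cong (edge≡arc∨arc a)) (count-∨ (arc-antisym f a))

  module _ (p q : Vertex N → Bool) (a b : Vertex N) where

    -- As `q a` fails, only arcs leaving `a` can be selected. The condition on `b` is asked only in
    -- the presence of an arc because it will come from adjacency.
    edgesFromTo-source : p a ≡ true → q a ≡ false → (T (arc f a b) → q b ≡ true) →
      edge (edgesFromTo p q f) a b ≡ arc f a b
    edgesFromTo-source pa qa qb
      rewrite pa | qa | ∧-zeroʳ (p b) | ∧-zeroʳ (arc f b a)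
            | ∨-identityʳ (arc f a b ∧ q b) with arc f a b
    ... | true  = qb _
    ... | false = refl

    edgesFromTo-target : p a ≡ false → q a ≡ true → (T (arc f b a) → p b ≡ true) →
      edge (edgesFromTo p q f) a b ≡ arc f b a
    edgesFromTo-target pa qa pb
      rewrite pa | qa | ∧-zeroʳ (arc f a b) | ∧-identityʳ (p b) with arc f b a
    ... | true  = pb _
    ... | false = refl

  Mₒ-odd : ∀ a → isOdd a ≡ true → ∀ b → edge (Mₒ f) a b ≡ arc f a b
  Mₒ-odd a odd b = edgesFromTo-source isOdd isEven a b odd (cong not odd)
    λ ab → cong not (odd-adjacent-even a b (arc-adjacent a b ab) odd)

  Mₒ-even : ∀ a → isOdd a ≡ false → ∀ b → edge (Mₒ f) a b ≡ arc f b a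
  Mₒ-even a even b = edgesFromTo-target isOdd isEven a b even (cong not even)
    λ ba → even-adjacent-odd a b (edge-adj (edges f) a b (Edge-sym (edges f) (arc⇒edge f b a ba))) even

  Mₑ-odd : ∀ a → isOdd a ≡ true → ∀ b → edge (Mₑ f) a b ≡ arc f b a
  Mₑ-odd a odd b = edgesFromTo-target isEven isOdd a b (cong not odd) odd
    λ ba → cong not (odd-adjacent-even a b
      (edge-adj (edges f) a b (Edge-sym (edges f) (arc⇒edge f b a ba))) odd)

  Mₑ-even : ∀ a → isOdd a ≡ false → ∀ b → edge (Mₑ f) a b ≡ arc f a b
  Mₑ-even a even b = edgesFromTo-source isEven isOdd a b (cong not even) even
    λ ab → even-adjacent-odd a b (arc-adjacent a b ab) even

  -- The inversion formula: it yields injectivity and dictates the orientation `orient` used for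
  -- surjectivity.
  arc≡M : ∀ a b → arc f a b ≡ (if isOdd a then edge (Mₒ f) a b else edge (Mₑ f) a b)
  arc≡M a b with ≡true⊎≡false (isOdd a)
  ... | inj₁ odd  = trans (sym (Mₒ-odd a odd b)) (sym (if-cong odd))
  ... | inj₂ even = trans (sym (Mₑ-even a even b)) (sym (if-cong even))

  no-arc-into-L : ∀ i b → ¬ T (arc f b (L i))
  no-arc-into-L i b bL = arc-antisym f b (L i)
    (bL , from-L f i b (Edge-sym (edges f) (arc⇒edge f b (L i) bL)))

  no-arc-from-R : ∀ i b → ¬ T (arc f (R i) b)
  no-arc-from-R i b Rb = arc-antisym f (R i) b (Rb , into-R f i b (arc⇒edge f (R i) b Rb))

  outDegree-L : ∀ i → outDegree f (L i) ≡ degree (edges f) (L i)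
  outDegree-L i = count-cong λ b → T⇒≡ (arc⇒edge f (L i) b) (from-L f i b)

  inDegree-R : ∀ i → inDegree f (R i) ≡ degree (edges f) (R i)
  inDegree-R i = count-cong {p = λ b → arc f b (R i)} λ b →
    T⇒≡ (λ bR → Edge-sym (edges f) (arc⇒edge f b (R i) bR)) (into-R f i b)

  -- Since `B i` has degree 1, exactly one of the premises of `boundary-w₁` and `boundary-w₀` holds,
  -- so these two implications determine the letter of `w`.
  B-orientation : ∀ i →
    (outDegree f (B i) ≡ 1 × inDegree f (B i) ≡ 0) ⊎ (outDegree f (B i) ≡ 0 × inDegree f (B i) ≡ 1)
  B-orientation i = m+n≡1⇒ _ _
    (trans (sym (degree≡out+in (B i))) (IsTFPL.degree-B (isTFPL f) i))

  balanced-other : ∀ a → (∀ i → a ≢ L i) → (∀ i → a ≢ R i) → (∀ i → a ≢ B i) →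
    inDegree f a ≡ 1 × outDegree f a ≡ 1
  balanced-other a ¬L ¬R ¬B = balanced f a (IsTFPL.degree-other (isTFPL f) a ¬L ¬R ¬B)

  -- A common edge would be oriented both ways.
  Mₒ-Mₑ-disjoint : Disjoint (Mₒ f) (Mₑ f)
  Mₒ-Mₑ-disjoint a b (eₒ , eₑ) with ≡true⊎≡false (isOdd a)
  ... | inj₁ odd  = arc-antisym f a b
    (subst T (Mₒ-odd a odd b) eₒ , subst T (Mₑ-odd a odd b) eₑ)
  ... | inj₂ even = arc-antisym f a b
    (subst T (Mₑ-even a even b) eₑ , subst T (Mₒ-even a even b) eₒ)

  module _ {u v w : Word N} (boundary : HasBoundary u v w f) where
    open HasBoundary boundary

    -- Each deleted vertex lacks the arc its colour would require: `R i` has no outgoing arc, `B i`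
    -- with letter 0 no incoming one, and `L i` with letter 0 no edge at all.
    Mₒ-vertex : ∀ a b → Edge (Mₒ f) a b → Gₒ u w a
    Mₒ-vertex a b e = ¬R , ¬B , ¬L
      where
      ¬R : ∀ i → a ≢ R i
      ¬R i refl = no-arc-from-R i b (subst T (Mₒ-odd (R i) (isOdd-R i) b) e)

      ¬B : ∀ i → lookup w i ≡ 0F → a ≢ B i
      ¬B i wᵢ≡0 refl with B-orientation i
      ... | inj₁ (_ , in≡0) = count≢0 (λ c → arc f c (B i)) (subst T (Mₒ-even (B i) (isOdd-B i) b) e) in≡0
      ... | inj₂ (_ , in≡1) = ≡1F⇒≢0F (boundary-w₁ i in≡1) wᵢ≡0

      ¬L : ∀ i → lookup u i ≡ 0F → a ≢ L i
      ¬L i uᵢ≡0 refl with IsTFPL.degree-L (isTFPL f) i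
      ... | inj₁ deg≡0 = count≢0 (edge (edges f) (L i))
        (arc⇒edge f (L i) b (subst T (Mₒ-odd (L i) (isOdd-L i) b) e)) deg≡0
      ... | inj₂ deg≡1 = ≡1F⇒≢0F (Equivalence.from (boundary-u i) deg≡1) uᵢ≡0

    Mₑ-vertex : ∀ a b → Edge (Mₑ f) a b → Gₑ v w a
    Mₑ-vertex a b e = ¬L , ¬B , ¬R
      where
      ¬L : ∀ i → a ≢ L i
      ¬L i refl = no-arc-into-L i b (subst T (Mₑ-odd (L i) (isOdd-L i) b) e)

      ¬B : ∀ i → lookup w i ≡ 1F → a ≢ B i
      ¬B i wᵢ≡1 refl with B-orientation i
      ... | inj₁ (out≡1 , _) = ≡1F⇒≢0F wᵢ≡1 (boundary-w₀ i out≡1)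
      ... | inj₂ (out≡0 , _) = count≢0 (arc f (B i)) (subst T (Mₑ-even (B i) (isOdd-B i) b) e) out≡0

      ¬R : ∀ i → lookup v i ≡ 1F → a ≢ R i
      ¬R i vᵢ≡1 refl with IsTFPL.degree-R (isTFPL f) i
      ... | inj₁ deg≡0 = count≢0 (λ c → arc f c (R i)) (subst T (Mₑ-odd (R i) (isOdd-R i) b) e)
                           (trans (inDegree-R i) deg≡0)
      ... | inj₂ deg≡1 = ≡1F⇒≢0F vᵢ≡1 (Equivalence.from (boundary-v i) deg≡1)

    Mₒ-covers : ∀ a → Gₒ u w a → degree (Mₒ f) a ≡ 1
    Mₒ-covers a (¬R , ¬B , ¬L) with kind a
    ... | right i  = contradiction refl (¬R i)
    ... | left i   = begin
      degree (Mₒ f) (L i)    ≡⟨ count-cong (Mₒ-odd (L i) (isOdd-L i)) ⟩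
      outDegree f (L i)      ≡⟨ outDegree-L i ⟩
      degree (edges f) (L i) ≡⟨ Equivalence.to (boundary-u i) (≢0F⇒≡1F λ uᵢ≡0 → ¬L i uᵢ≡0 refl) ⟩
      1                      ∎
      where open ≡-Reasoning
    ... | bottom i with B-orientation i
    ...   | inj₁ (out≡1 , _) = contradiction refl (¬B i (boundary-w₀ i out≡1))
    ...   | inj₂ (_ , in≡1)  = trans (count-cong (Mₒ-even (B i) (isOdd-B i))) in≡1
    -- Indegree and outdegree are both 1 here; the colour only decides which of them is the degree
    -- in `Mₒ f`.
    Mₒ-covers a _ | other ¬L ¬R ¬B with ≡true⊎≡false (isOdd a)
    ... | inj₁ odd  = trans (count-cong (Mₒ-odd a odd)) (proj₂ (balanced-other a ¬L ¬R ¬B))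
    ... | inj₂ even = trans (count-cong (Mₒ-even a even)) (proj₁ (balanced-other a ¬L ¬R ¬B))

    Mₑ-covers : ∀ a → Gₑ v w a → degree (Mₑ f) a ≡ 1
    Mₑ-covers a (¬L , ¬B , ¬R) with kind a
    ... | left i   = contradiction refl (¬L i)
    ... | right i  = begin
      degree (Mₑ f) (R i)    ≡⟨ count-cong (Mₑ-odd (R i) (isOdd-R i)) ⟩
      inDegree f (R i)       ≡⟨ inDegree-R i ⟩
      degree (edges f) (R i) ≡⟨ Equivalence.to (boundary-v i) (≢1F⇒≡0F λ vᵢ≡1 → ¬R i vᵢ≡1 refl) ⟩
      1                      ∎
      where open ≡-Reasoning
    ... | bottom i with B-orientation i
    ...   | inj₁ (out≡1 , _) = trans (count-cong (Mₑ-even (B i) (isOdd-B i))) out≡1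
    ...   | inj₂ (_ , in≡1)  = contradiction refl (¬B i (boundary-w₁ i in≡1))
    Mₑ-covers a _ | other ¬L ¬R ¬B with ≡true⊎≡false (isOdd a)
    ... | inj₁ odd  = trans (count-cong (Mₑ-odd a odd)) (proj₁ (balanced-other a ¬L ¬R ¬B))
    ... | inj₂ even = trans (count-cong (Mₑ-even a even)) (proj₂ (balanced-other a ¬L ¬R ¬B))

    isMatchingPair : IsMatchingPair u v w (Mₒ f , Mₑ f)
    isMatchingPair = record
      { matchingₒ = record
        { within = λ a b e → Mₒ-vertex a b e , Mₒ-vertex b a (Edge-sym (Mₒ f) e)
        ; covers = Mₒ-covers
        }
      ; matchingₑ = record
        { within = λ a b e → Mₑ-vertex a b e , Mₑ-vertex b a (Edge-sym (Mₑ f) e)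
        ; covers = Mₑ-covers
        }
      ; disjoint  = Mₒ-Mₑ-disjoint
      }

-- Comparison of two oriented TFPLs

module _ {N : ℕ} (f g : OrientedTFPL N) where

  arc-determined : Mₒ f ≈ᴱ Mₒ g → Mₑ f ≈ᴱ Mₑ g → ∀ a b → arc f a b ≡ arc g a b
  arc-determined eqₒ eqₑ a b = begin
    arc f a b
      ≡⟨ arc≡M f a b ⟩
    (if isOdd a then edge (Mₒ f) a b else edge (Mₑ f) a b)
      ≡⟨ cong₂ (if isOdd a then_else_) (eqₒ a b) (eqₑ a b) ⟩
    (if isOdd a then edge (Mₒ g) a b else edge (Mₑ g) a b)
      ≡⟨ arc≡M g a b ⟨
    arc g a b ∎
    where open ≡-Reasoning

  edges-determined : (∀ a b → arc f a b ≡ arc g a b) → edges f ≈ᴱ edges g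
  edges-determined eq a b = trans (edge≡arc∨arc f a b)
    (trans (cong₂ _∨_ (eq a b) (eq b a)) (sym (edge≡arc∨arc g a b)))

  edgesFromTo-cong : (∀ a b → arc f a b ≡ arc g a b) →
    ∀ p q → edgesFromTo p q f ≈ᴱ edgesFromTo p q g
  edgesFromTo-cong eq p q a b =
    cong₂ (λ x y → (x ∧ (p a ∧ q b)) ∨ (y ∧ (p b ∧ q a))) (eq a b) (eq b a)

-- From matchings to oriented TFPLs

module _ {N : ℕ} {S : Vertex N → Set} {M : EdgeSet N} (matching : IsPerfectMatching S M) where
  open IsPerfectMatching matching

  matching-unique : ∀ {a b c} → Edge M a b → Edge M a c → b ≡ c
  matching-unique {a} {b} ab = count≡1⇒unique (edge M a) (covers a (proj₁ (within a b ab))) ab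

  -- A single edge at `a` already places `a` in `S`, where the degree is 1.
  degree≡0⊎1 : ∀ a → degree M a ≡ 0 ⊎ degree M a ≡ 1
  degree≡0⊎1 a with count≡0⊎∃ (edge M a)
  ... | inj₁ eq       = inj₁ eq
  ... | inj₂ (b , ab) = inj₂ (covers a (proj₁ (within a b ab)))

  degree≡0 : ∀ {a} → ¬ S a → degree M a ≡ 0
  degree≡0 {a} a∉S = count≡0 (edge M a) λ b ab → a∉S (proj₁ (within a b ab))

  -- Together with `covers` this makes `S` the set of vertices of degree 1, so boundary words can be
  -- read off from degrees.
  degree≡1⇒∈ : ∀ {a} → degree M a ≡ 1 → S a
  degree≡1⇒∈ {a} eq = let (b , ab) = count≡1⇒∃ (edge M a) eq in proj₁ (within a b ab)

module FromMatchings {N : ℕ} {u v w : Word N} {M K : EdgeSet N}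
  (pair : IsMatchingPair u v w (M , K)) where
  open IsMatchingPair pair

  union : EdgeSet N
  union = record
    { edge     = λ a b → edge M a b ∨ edge K a b
    ; edge-sym = λ a b → cong₂ _∨_ (edge-sym M a b) (edge-sym K a b)
    ; edge-adj = λ a b e → [ edge-adj M a b , edge-adj K a b ]′ (Equivalence.to T-∨ e)
    }

  orient : Vertex N → Vertex N → Bool
  orient a b = if isOdd a then edge M a b else edge K a b

  orient-odd : ∀ a → isOdd a ≡ true → ∀ b → orient a b ≡ edge M a b
  orient-odd a odd b = if-cong odd

  orient-even : ∀ a → isOdd a ≡ false → ∀ b → orient a b ≡ edge K a b
  orient-even a even b = if-cong even

  orient⇒edge : ∀ a b → T (orient a b) → Edge union a b
  orient⇒edge a b ab with ≡true⊎≡false (isOdd a)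
  ... | inj₁ odd  = Equivalence.from T-∨ (inj₁ (subst T (orient-odd a odd b) ab))
  ... | inj₂ even = Equivalence.from T-∨ (inj₂ (subst T (orient-even a even b) ab))

  orient-adjacent : ∀ a b → T (orient b a) → Adjacent a b
  orient-adjacent a b ba = edge-adj union a b (Edge-sym union (orient⇒edge b a ba))

  -- `orient` looks only at the colour of the tail. By bipartiteness the tail of an arc into an odd
  -- vertex is even, so the arc comes from `K`.
  orient-into-odd : ∀ a → isOdd a ≡ true → ∀ b → orient b a ≡ edge K a b
  orient-into-odd a odd b = T⇒≡
    (λ ba → Edge-sym K (subst T
      (orient-even b (odd-adjacent-even a b (orient-adjacent a b ba) odd) a) ba))
    (λ ab → subst T
      (sym (orient-even b (odd-adjacent-even a b (edge-adj K a b ab) odd) a)) (Edge-sym K ab))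

  orient-into-even : ∀ a → isOdd a ≡ false → ∀ b → orient b a ≡ edge M a b
  orient-into-even a even b = T⇒≡
    (λ ba → Edge-sym M (subst T
      (orient-odd b (even-adjacent-odd a b (orient-adjacent a b ba) even) a) ba))
    (λ ab → subst T
      (sym (orient-odd b (even-adjacent-odd a b (edge-adj M a b ab) even) a)) (Edge-sym M ab))

  edge⇒orient : ∀ a b → Edge union a b → T (orient a b) ⊎ T (orient b a)
  edge⇒orient a b e with ≡true⊎≡false (isOdd a) | Equivalence.to T-∨ e
  ... | inj₁ odd  | inj₁ m = inj₁ (subst T (sym (orient-odd a odd b)) m)
  ... | inj₁ odd  | inj₂ k = inj₂ (subst T (sym (orient-into-odd a odd b)) k)
  ... | inj₂ even | inj₁ m = inj₂ (subst T (sym (orient-into-even a even b)) m)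
  ... | inj₂ even | inj₂ k = inj₁ (subst T (sym (orient-even a even b)) k)

  orient-antisym : ∀ a b → ¬ (T (orient a b) × T (orient b a))
  orient-antisym a b (ab , ba) with ≡true⊎≡false (isOdd a)
  ... | inj₁ odd  = disjoint a b
    (subst T (orient-odd a odd b) ab , subst T (orient-into-odd a odd b) ba)
  ... | inj₂ even = disjoint a b
    (subst T (orient-into-even a even b) ba , subst T (orient-even a even b) ab)

  -- All arcs into `b` come from the same matching, chosen by the colour of `b`.
  orient-injective : ∀ {a b c} → T (orient a b) → T (orient c b) → a ≡ c
  orient-injective {a} {b} {c} ab cb with ≡true⊎≡false (isOdd b)
  ... | inj₁ odd  = matching-unique matchingₑ
    (subst T (orient-into-odd b odd a) ab) (subst T (orient-into-odd b odd c) cb)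
  ... | inj₂ even = matching-unique matchingₒ
    (subst T (orient-into-even b even a) ab) (subst T (orient-into-even b even c) cb)

  orient-functional : ∀ {a b c} → T (orient b a) → T (orient b c) → a ≡ c
  orient-functional {a} {b} {c} ba bc with ≡true⊎≡false (isOdd b)
  ... | inj₁ odd  = matching-unique matchingₒ
    (subst T (orient-odd b odd a) ba) (subst T (orient-odd b odd c) bc)
  ... | inj₂ even = matching-unique matchingₑ
    (subst T (orient-even b even a) ba) (subst T (orient-even b even c) bc)

  degree-union : ∀ a → degree union a ≡ degree M a + degree K a
  degree-union a = count-∨ (disjoint a)

  L∉Gₑ : ∀ i → ¬ Gₑ v w (L i)
  L∉Gₑ i (¬L , _) = ¬L i refl

  R∉Gₒ : ∀ i → ¬ Gₒ u w (R i)
  R∉Gₒ i (¬R , _) = ¬R i refl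

  degree-union-L : ∀ i → degree union (L i) ≡ degree M (L i)
  degree-union-L i = begin
    degree union (L i)              ≡⟨ degree-union (L i) ⟩
    degree M (L i) + degree K (L i) ≡⟨ cong (λ k → degree M (L i) + k) (degree≡0 matchingₑ (L∉Gₑ i)) ⟩
    degree M (L i) + 0              ≡⟨ +-identityʳ (degree M (L i)) ⟩
    degree M (L i)                  ∎
    where open ≡-Reasoning

  degree-union-R : ∀ i → degree union (R i) ≡ degree K (R i)
  degree-union-R i = trans (degree-union (R i))
    (cong (λ k → k + degree K (R i)) (degree≡0 matchingₒ (R∉Gₒ i)))

  union-from-L : ∀ i b → Edge union (L i) b → T (orient (L i) b)
  union-from-L i b e with Equivalence.to T-∨ e
  ... | inj₁ m = subst T (sym (orient-odd (L i) (isOdd-L i) b)) m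
  ... | inj₂ k = contradiction (proj₁ (IsPerfectMatching.within matchingₑ _ _ k)) (L∉Gₑ i)

  union-into-R : ∀ i b → Edge union (R i) b → T (orient b (R i))
  union-into-R i b e with Equivalence.to T-∨ e
  ... | inj₁ m = contradiction (proj₁ (IsPerfectMatching.within matchingₒ _ _ m)) (R∉Gₒ i)
  ... | inj₂ k = subst T (sym (orient-into-odd (R i) (isOdd-R i) b)) k

  no-path-between-L : ∀ i j → i ≢ j → ¬ Path union (L i) (L j)
  no-path-between-L i j i≢j (_ ∷ _ , linked , unique , refl , eq) =
    no-path-from-source {D = λ a b → T (orient a b)} (λ {a} {b} → edge⇒orient a b)
      orient-injective
      (λ {b} → union-from-L i b)
      -- An arc into `L j` would also be oriented away from `L j`.
      (λ {b} bL → orient-antisym (L j) b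
        (union-from-L j b (Edge-sym union (orient⇒edge b (L j) bL)) , bL))
      (λ Lᵢ≡Lⱼ → i≢j (L-injective i j Lᵢ≡Lⱼ)) linked unique eq

  no-path-between-R : ∀ i j → i ≢ j → ¬ Path union (R i) (R j)
  no-path-between-R i j i≢j (_ ∷ _ , linked , unique , refl , eq) =
    -- With all arcs reversed the sinks `R i` and `R j` become sources, and uniqueness of outgoing
    -- arcs takes the place of uniqueness of incoming ones.
    no-path-from-source {D = λ a b → T (orient b a)} (λ {a} {b} e → swap (edge⇒orient a b e))
      orient-functional
      (λ {b} → union-into-R i b)
      (λ {b} Rb → orient-antisym (R j) b (Rb , union-into-R j b (orient⇒edge (R j) b Rb)))
      (λ Rᵢ≡Rⱼ → i≢j (R-injective i j Rᵢ≡Rⱼ)) linked unique eq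

  union-isTFPL : IsTFPL union
  union-isTFPL = record
    { degree-L     = λ i → subst (λ d → d ≡ 0 ⊎ d ≡ 1) (sym (degree-union-L i))
        (degree≡0⊎1 matchingₒ (L i))
    ; degree-R     = λ i → subst (λ d → d ≡ 0 ⊎ d ≡ 1) (sym (degree-union-R i))
        (degree≡0⊎1 matchingₑ (R i))
    ; degree-B     = λ i → trans (degree-union (B i)) (at-B i (≡0F⊎≡1F (lookup w i)))
    -- Such a vertex survives the deletions in both graphs, so each matching contributes 1.
    ; degree-other = λ a ¬L ¬R ¬B → trans (degree-union a) (cong₂ _+_
        (IsPerfectMatching.covers matchingₒ a (¬R , (λ i _ → ¬B i) , (λ i _ → ¬L i)))
        (IsPerfectMatching.covers matchingₑ a (¬L , (λ i _ → ¬B i) , (λ i _ → ¬R i))))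
    ; no-path-L    = no-path-between-L
    ; no-path-R    = no-path-between-R
    }
    where
    -- The letter of `w` decides which one of the two graphs keeps `B i`.
    at-B : ∀ i → lookup w i ≡ 0F ⊎ lookup w i ≡ 1F → degree M (B i) + degree K (B i) ≡ 1
    at-B i (inj₁ wᵢ≡0) = cong₂ _+_
      (degree≡0 matchingₒ λ (_ , ¬B , _) → ¬B i wᵢ≡0 refl)
      (IsPerfectMatching.covers matchingₑ _ (B∈Gₑ v w i wᵢ≡0))
    at-B i (inj₂ wᵢ≡1) = cong₂ _+_
      (IsPerfectMatching.covers matchingₒ _ (B∈Gₒ u w i wᵢ≡1))
      (degree≡0 matchingₑ λ (_ , ¬B , _) → ¬B i wᵢ≡1 refl)

  -- Each matching contributes at most 1, so a degree of 2 can only be 1 + 1; one of the two edges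
  -- is incoming and the other outgoing.
  union-balanced : ∀ a → degree union a ≡ 2 →
    count (λ b → orient b a) ≡ 1 × count (orient a) ≡ 1
  union-balanced a deg≡2
    with degree≡0⊎1 matchingₒ a | degree≡0⊎1 matchingₑ a | trans (sym (degree-union a)) deg≡2
  ... | inj₁ m | inj₁ k | eq = contradiction (trans (sym (cong₂ _+_ m k)) eq) λ ()
  ... | inj₁ m | inj₂ k | eq = contradiction (trans (sym (cong₂ _+_ m k)) eq) λ ()
  ... | inj₂ m | inj₁ k | eq = contradiction (trans (sym (cong₂ _+_ m k)) eq) λ ()
  ... | inj₂ m | inj₂ k | _ with ≡true⊎≡false (isOdd a)
  ...   | inj₁ odd  =
    trans (count-cong (orient-into-odd a odd)) k , trans (count-cong (orient-odd a odd)) m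
  ...   | inj₂ even =
    trans (count-cong (orient-into-even a even)) m , trans (count-cong (orient-even a even)) k

  tfpl : OrientedTFPL N
  tfpl = record
    { edges       = union
    ; isTFPL      = union-isTFPL
    ; arc         = orient
    ; arc⇒edge    = orient⇒edge
    ; edge⇒arc    = edge⇒orient
    ; arc-antisym = orient-antisym
    ; balanced    = union-balanced
    ; from-L      = union-from-L
    ; into-R      = union-into-R
    }

  tfpl-boundary : HasBoundary u v w tfpl
  tfpl-boundary = record
    { boundary-u  = λ i → mk⇔
        (λ uᵢ≡1 → trans (degree-union-L i) (IsPerfectMatching.covers matchingₒ _ (L∈Gₒ u w i uᵢ≡1)))
        (λ deg≡1 → let (_ , _ , ¬L) = degree≡1⇒∈ matchingₒ (trans (sym (degree-union-L i)) deg≡1)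
                   in ≢0F⇒≡1F λ uᵢ≡0 → ¬L i uᵢ≡0 refl)
    ; boundary-v  = λ i → mk⇔
        (λ vᵢ≡0 → trans (degree-union-R i) (IsPerfectMatching.covers matchingₑ _ (R∈Gₑ v w i vᵢ≡0)))
        (λ deg≡1 → let (_ , _ , ¬R) = degree≡1⇒∈ matchingₑ (trans (sym (degree-union-R i)) deg≡1)
                   in ≢1F⇒≡0F λ vᵢ≡1 → ¬R i vᵢ≡1 refl)
    -- The indegree of the even vertex `B i` is its degree in `M`, so `B i` lies in `Gₒ u w`, which
    -- rules out the letter 0.
    ; boundary-w₁ = λ i in≡1 →
        let (_ , ¬B , _) = degree≡1⇒∈ matchingₒ
              (trans (sym (count-cong (orient-into-even (B i) (isOdd-B i)))) in≡1)
        in ≢0F⇒≡1F λ wᵢ≡0 → ¬B i wᵢ≡0 refl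
    ; boundary-w₀ = λ i out≡1 →
        let (_ , ¬B , _) = degree≡1⇒∈ matchingₑ
              (trans (sym (count-cong (orient-even (B i) (isOdd-B i)))) out≡1)
        in ≢1F⇒≡0F λ wᵢ≡1 → ¬B i wᵢ≡1 refl
    }

  Mₒ-tfpl : Mₒ tfpl ≈ᴱ M
  Mₒ-tfpl a b with ≡true⊎≡false (isOdd a)
  ... | inj₁ odd  = trans (Mₒ-odd tfpl a odd b) (orient-odd a odd b)
  ... | inj₂ even = trans (Mₒ-even tfpl a even b) (orient-into-even a even b)

  Mₑ-tfpl : Mₑ tfpl ≈ᴱ K
  Mₑ-tfpl a b with ≡true⊎≡false (isOdd a)
  ... | inj₁ odd  = trans (Mₑ-odd tfpl a odd b) (orient-into-odd a odd b)
  ... | inj₂ even = trans (Mₑ-even tfpl a even b) (orient-even a even b)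

theorem3p3 : (N : ℕ) → 1 ≤ N → (u v w : Word N) →
    Σ[ wd ∈ ((f : BoundedTFPL u v w) → IsMatchingPair u v w (toMatchings f)) ]
    Bijective (_≈ᵀ_ {u = u} {v} {w}) (_≈ᴹ_ {u = u} {v} {w})
    (λ f → toMatchings f , wd f)
theorem3p3 N _ u v w = (λ (f , boundary) → isMatchingPair f boundary) ,
  (λ {f} {g} → injective {f} {g}) , surjective
  where
  injective : ∀ {f g : BoundedTFPL u v w} →
    Mₒ (proj₁ f) ≈ᴱ Mₒ (proj₁ g) × Mₑ (proj₁ f) ≈ᴱ Mₑ (proj₁ g) → _≈ᵀ_ {u = u} {v} {w} f g
  injective {f , _} {g , _} (eqₒ , eqₑ) = edges-determined f g arcs≡ , arcs≡
    where
    arcs≡ : ∀ a b → arc f a b ≡ arc g a b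
    arcs≡ = arc-determined f g eqₒ eqₑ

  surjective : (M : MatchingPair u v w) → Σ[ f ∈ BoundedTFPL u v w ]
    (∀ {g : BoundedTFPL u v w} → _≈ᵀ_ {u = u} {v} {w} g f →
      Mₒ (proj₁ g) ≈ᴱ proj₁ (proj₁ M) × Mₑ (proj₁ g) ≈ᴱ proj₂ (proj₁ M))
  -- Surjectivity between setoids concerns every `g` equal to the preimage; having the same arcs,
  -- `g` has the same two matchings.
  surjective (_ , pair) = (tfpl , tfpl-boundary) , λ {(g , _)} (_ , arcs≡) →
    (λ a b → trans (edgesFromTo-cong g tfpl arcs≡ isOdd isEven a b) (Mₒ-tfpl a b)) ,
    (λ a b → trans (edgesFromTo-cong g tfpl arcs≡ isEven isOdd a b) (Mₑ-tfpl a b))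
    where open FromMatchings pair
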